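{- Let $V$ be the set of pairs $(\Gamma,\phi)$ where $\Gamma$ is a finite s-theory, $\phi$ is an s-formula, and $\phi$ is a strict consequence of $\Gamma$. Then, under a standard Gödel numbering of formulas and finite sets of formulas, the set $V$ is computable.
   Context: Fix a countably infinite set $\Sigma=\{X_0,X_1,\dots\}$ of propositional variables, with a fixed enumeration used for the Gödel numbering. Propositional formulas are built from $\Sigma$ using $\lnot$, $\land$, $\lor$, $\to$. An s-formula is an expression of the form $A \prec B$ (a strict implication) or $A \not\prec B$ (a strict nonimplication), where $A$ and $B$ are propositional formulas; $\prec$ and $\not\prec$ are two formal symbols, not nested. An s-theory is a set of s-formulas. A valuation is a function $w:\Sigma\to\{T,F\}$, extended in the usual way to all propositional formulas. A frame is a nonempty set of valuations. A frame $R$ satisfies $A \prec B$ if for every $w\in R$, $w(A)=F$ or $w(B)=T$. A frame $R$ satisfies $A\not\prec B$ if there is some $w\in R$ with $w(A)=T$ and $w(B)=F$. A frame satisfies an s-theory if it satisfies every member. An s-formula $\phi$ is a strict consequence of an s-theory $\Gamma$ if every frame that satisfies $\Gamma$ satisfies $\phi$. -}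

module Defs where

open import Level using (Level; 0ℓ; _⊔_) renaming (suc to lsuc)
open import Data.Bool using (Bool; true; false; not; _∧_; _∨_)
open import Data.Nat using (ℕ; zero; suc; _+_; _*_; _^_; _<_; _≟_)
open import Data.Fin using (Fin)
open import Data.Vec using (Vec; []; _∷_; lookup)
open import Data.Vec.Relation.Binary.Pointwise.Inductive using (Pointwise)
open import Data.List using (List; map; deduplicate)
open import Data.Nat.ListAction using (sum)
import Data.List.Membership.Propositional as List
open import Data.Product using (Σ; ∃; ∃-syntax; _×_; _,_)
open import Data.Sum using (_⊎_)
open import Function.Bundles using (_⇔_)
open import Relation.Unary using (Pred; _∈_; _∉_; Satisfiable)
open import Relation.Binary.PropositionalEquality using (_≡_)

infix  9 ¬′_
infixr 8 _∧′_
infixr 7 _∨′_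
infixr 6 _⇒′_
infix  5 _≺_ _⊀_
infix  4 _⊩_ _⊩ᵗ_ _⊨_ _[_]⇓_

data Formula : Set where
  X              : ℕ → Formula
  ¬′_            : Formula → Formula
  _∧′_ _∨′_ _⇒′_ : Formula → Formula → Formula

data SFormula : Set where
  _≺_ _⊀_ : Formula → Formula → SFormula

STheory : Set₁
STheory = Pred SFormula 0ℓ

Valuation : Set
Valuation = ℕ → Bool

⟦_⟧ : Formula → Valuation → Bool
⟦ X n ⟧    w = w n
⟦ ¬′ A ⟧   w = not (⟦ A ⟧ w)
⟦ A ∧′ B ⟧ w = ⟦ A ⟧ w ∧ ⟦ B ⟧ w
⟦ A ∨′ B ⟧ w = ⟦ A ⟧ w ∨ ⟦ B ⟧ w
⟦ A ⇒′ B ⟧ w = not (⟦ A ⟧ w) ∨ ⟦ B ⟧ w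

Frame : Set₁
Frame = Σ (Pred Valuation 0ℓ) Satisfiable

_⊩_ : Frame → SFormula → Set
(R , _) ⊩ (A ≺ B) = ∀ w → w ∈ R → ⟦ A ⟧ w ≡ false ⊎ ⟦ B ⟧ w ≡ true
(R , _) ⊩ (A ⊀ B) = ∃[ w ] (w ∈ R × ⟦ A ⟧ w ≡ true × ⟦ B ⟧ w ≡ false)

_⊩ᵗ_ : Frame → STheory → Set
R ⊩ᵗ Γ = ∀ ψ → ψ ∈ Γ → R ⊩ ψ

_⊨_ : STheory → SFormula → Set₁
Γ ⊨ φ = ∀ (R : Frame) → R ⊩ᵗ Γ → R ⊩ φ

Finite : STheory → Set
Finite Γ = ∃[ ψs ] (∀ ψ → ψ ∈ Γ ⇔ ψ List.∈ ψs)

FiniteSTheory : Set₁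
FiniteSTheory = ∃ Finite

V : Pred (FiniteSTheory × SFormula) (lsuc 0ℓ)
V ((Γ , _) , φ) = Γ ⊨ φ

triangular : ℕ → ℕ
triangular zero    = zero
triangular (suc n) = suc n + triangular n

-- Cantor's pairing bijection.
⟨_,_⟩ : ℕ → ℕ → ℕ
⟨ m , n ⟩ = triangular (m + n) + m

codeFormula : Formula → ℕ
codeFormula (X n)    = 0 + 5 * n
codeFormula (¬′ A)   = 1 + 5 * codeFormula A
codeFormula (A ∧′ B) = 2 + 5 * ⟨ codeFormula A , codeFormula B ⟩
codeFormula (A ∨′ B) = 3 + 5 * ⟨ codeFormula A , codeFormula B ⟩
codeFormula (A ⇒′ B) = 4 + 5 * ⟨ codeFormula A , codeFormula B ⟩

codeSFormula : SFormula → ℕ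
codeSFormula (A ≺ B) = 0 + 2 * ⟨ codeFormula A , codeFormula B ⟩
codeSFormula (A ⊀ B) = 1 + 2 * ⟨ codeFormula A , codeFormula B ⟩

-- Canonical index of a finite set of numbers: the sum of 2 ^ n over its members n.
-- Removing duplicates makes it depend only on the set, not on how it is listed.
canonicalIndex : List ℕ → ℕ
canonicalIndex ns = sum (map (2 ^_) (deduplicate _≟_ ns))

codeFiniteSTheory : FiniteSTheory → ℕ
codeFiniteSTheory (_ , ψs , _) = canonicalIndex (map codeSFormula ψs)

codePair : FiniteSTheory × SFormula → ℕ
codePair (Γ , φ) = ⟨ codeFiniteSTheory Γ , codeSFormula φ ⟩

-- Partial recursive functions, by arity.
data Rec : ℕ → Set where
  zeroᴿ : Rec 0
  sucᴿ  : Rec 1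
  projᴿ : ∀ {n} → Fin n → Rec n
  compᴿ : ∀ {m n} → Rec m → Vec (Rec n) m → Rec n
  precᴿ : ∀ {n} → Rec n → Rec (suc (suc n)) → Rec (suc n)
  muᴿ   : ∀ {n} → Rec (suc n) → Rec n

-- f [ xs ]⇓ y : the partial function f is defined at xs, with value y.
data _[_]⇓_ : ∀ {n} → Rec n → Vec ℕ n → ℕ → Set where
  ⇓zero : zeroᴿ [ [] ]⇓ 0
  ⇓suc  : ∀ {x} → sucᴿ [ x ∷ [] ]⇓ suc x
  ⇓proj : ∀ {n} {xs : Vec ℕ n} (i : Fin n) → projᴿ i [ xs ]⇓ lookup xs i
  ⇓comp : ∀ {m n} {f : Rec m} {gs : Vec (Rec n) m} {xs ys z} →
          Pointwise (λ g y → g [ xs ]⇓ y) gs ys → f [ ys ]⇓ z →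
          compᴿ f gs [ xs ]⇓ z
  ⇓prec-zero : ∀ {n} {f : Rec n} {g : Rec (suc (suc n))} {xs y} →
          f [ xs ]⇓ y → precᴿ f g [ 0 ∷ xs ]⇓ y
  ⇓prec-suc : ∀ {n} {f : Rec n} {g : Rec (suc (suc n))} {k xs y z} →
          precᴿ f g [ k ∷ xs ]⇓ y → g [ k ∷ y ∷ xs ]⇓ z →
          precᴿ f g [ suc k ∷ xs ]⇓ z
  ⇓mu   : ∀ {n} {f : Rec (suc n)} {xs k} →
          f [ k ∷ xs ]⇓ 0 → (∀ j → j < k → ∃[ y ] f [ j ∷ xs ]⇓ suc y) →
          muᴿ f [ xs ]⇓ k

private
  variable
    a ℓ : Level

-- The characteristic function is total recursive. Stated as a disjunction because, without
-- excluded middle, (n ∈ S → f ⇓ 1) × (n ∉ S → f ⇓ 0) would not make f total.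
ComputableSet : Pred ℕ ℓ → Set ℓ
ComputableSet S = ∃[ f ] (∀ n → (n ∈ S × f [ n ∷ [] ]⇓ 1) ⊎ (n ∉ S × f [ n ∷ [] ]⇓ 0))

Image : {A : Set a} → (A → ℕ) → Pred A ℓ → Pred ℕ (a ⊔ ℓ)
Image code P n = ∃[ x ] (x ∈ P × code x ≡ n)

ComputableUnder : {A : Set a} → (A → ℕ) → Pred A ℓ → Set (a ⊔ ℓ)
ComputableUnder code P = ComputableSet (Image code P)

{-# OPTIONS --safe #-}

-- Γ ⊨ φ holds exactly when Γ ∪ {¬φ} has no frame, where ¬φ exchanges ≺ and ⊀. The valuations
-- satisfying all strict implications of a finite theory form its largest candidate frame, so the
-- theory has a frame iff some such valuation exists and each strict nonimplication is witnessed
-- by one. Only the values of formulas with codes below a bound N matter, and a valuation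
-- restricted to those is a number t < 2 ^ N whose bits obey the truth tables. Satisfiability is
-- thereby a bounded quantification over numbers, built from +, *, ∸, 2 ^ and bit extraction,
-- and every such condition has a recursive characteristic function.
module Submission where

open import Defs
open import Data.Bool using (Bool; true; false; not; _∧_; _∨_)
import Data.Bool.Properties as Bool
open import Data.Empty using (⊥-elim)
open import Data.Fin using (Fin; zero; suc)
open import Data.Fin.Patterns using (0F; 1F; 2F; 4F)
open import Data.List using (List; []; _∷_; map; filter; upTo)
open import Data.List.Membership.Propositional using (find; lose) renaming (_∈_ to _∈ˡ_; _∉_ to _∉ˡ_)
open import Data.List.Membership.Propositional.Properties
open import Data.List.Relation.Unary.All as All using (All; []; _∷_)
open import Data.List.Relation.Unary.All.Properties using (All¬⇒¬Any)
open import Data.List.Relation.Unary.AllPairs using ([]; _∷_)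
open import Data.List.Relation.Unary.Any using (here; there; any?)
open import Data.List.Relation.Unary.Unique.DecPropositional.Properties using (deduplicate-!)
open import Data.List.Relation.Unary.Unique.Propositional using (Unique)
open import Data.Nat
  using (ℕ; zero; suc; pred; _+_; _*_; _∸_; _^_; _/_; _%_; _⊔_; _≤_; _<_; _≟_; s≤s; z≤n)
open import Data.Nat.Divisibility using (divides-refl)
open import Data.Nat.DivMod
  using (m%n<n; m≡m%n+[m/n]*n; [m+kn]%n≡m%n; m<n⇒m%n≡m; m<n⇒m/n≡0; m*n/n≡m; +-distrib-/-∣ʳ)
open import Data.Nat.ListAction using (sum)
open import Data.Nat.Properties
open import Data.Product using (∃-syntax; _×_; _,_; proj₁; proj₂; uncurry)
open import Data.Sum using (_⊎_; inj₁; inj₂)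
open import Data.Vec using (Vec; []; _∷_; lookup; head; tail; tabulate)
open import Data.Vec.Relation.Binary.Pointwise.Inductive using (Pointwise; []; _∷_)
open import Function using (_∘_; id; _⇔_; mk⇔; Equivalence)
open import Function.Construct.Identity using (⇔-id)
open import Level using (Level)
open import Relation.Binary.PropositionalEquality
open import Relation.Nullary using (¬_; yes; no)
open import Relation.Nullary.Decidable using (_×-dec_)
open import Relation.Unary using (Pred; _∈_; _∉_)

open Equivalence using (to; from)

private
  variable
    m n : ℕ
    ℓ   : Level

-- Binary digits and bounded products as numerical functions

𝟙 : Bool → ℕ
𝟙 false = 0
𝟙 true  = 1

odd : ℕ → Bool
odd zero    = false
odd (suc n) = not (odd n)

-- `half` and `shift` call themselves only at the predecessor, so that each fits the scheme of
-- primitive recursion.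
half : ℕ → ℕ
half zero    = 0
half (suc n) = half n + 𝟙 (odd n)

shift : ℕ → ℕ → ℕ
shift zero    x = x
shift (suc i) x = half (shift i x)

bit : ℕ → ℕ → Bool
bit i x = odd (shift i x)

∏< : ℕ → (ℕ → ℕ) → ℕ
∏< zero    f = 1
∏< (suc k) f = ∏< k f * f k

𝟙-not : ∀ b → 𝟙 (not b) ≡ 1 ∸ 𝟙 b
𝟙-not false = refl
𝟙-not true  = refl

-- Recursive functions and recursive predicates

-- The value is kept as an Agda function beside the program, so that conditions built from such
-- terms reduce to ordinary statements about numbers. Arguments form an environment addressed by de
-- Bruijn indices.
record Computable (n : ℕ) : Set where
  field
    value   : Vec ℕ n → ℕ
    program : Rec n
    correct : ∀ xs → program [ xs ]⇓ value xs

open Computable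

projections : ∀ (ρ : Fin m → Fin n) xs ys → (∀ i → lookup xs (ρ i) ≡ lookup ys i) →
              Pointwise (λ g y → g [ xs ]⇓ y) (tabulate (projᴿ ∘ ρ)) ys
projections ρ xs []       eq = []
projections ρ xs (y ∷ ys) eq =
  subst (projᴿ (ρ 0F) [ xs ]⇓_) (eq 0F) (⇓proj (ρ 0F)) ∷ projections (ρ ∘ suc) xs ys (eq ∘ suc)

var : Fin n → Computable n
var i = record { value = λ xs → lookup xs i ; program = projᴿ i ; correct = λ _ → ⇓proj i }

app₁ : Computable 1 → Computable n → Computable n
app₁ f s = record
  { value   = λ xs → value f (value s xs ∷ [])
  ; program = compᴿ (program f) (program s ∷ [])
  ; correct = λ xs → ⇓comp (correct s xs ∷ []) (correct f _)
  }

app₂ : Computable 2 → Computable n → Computable n → Computable n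
app₂ f s t = record
  { value   = λ xs → value f (value s xs ∷ value t xs ∷ [])
  ; program = compᴿ (program f) (program s ∷ program t ∷ [])
  ; correct = λ xs → ⇓comp (correct s xs ∷ correct t xs ∷ []) (correct f _)
  }

bind : Computable n → Computable (suc n) → Computable n
bind s t = record
  { value   = λ xs → value t (value s xs ∷ xs)
  ; program = compᴿ (program t) (program s ∷ tabulate projᴿ)
  ; correct = λ xs → ⇓comp (correct s xs ∷ projections id xs xs (λ _ → refl)) (correct t _)
  }

-- The intended function `f` is given in advance and two equations tie it to the programs; `value`
-- is then `f` itself instead of a recursor.
primrec : (f : ℕ → Vec ℕ n → ℕ) (s : Computable n) (t : Computable (suc (suc n))) →
          (∀ xs → value s xs ≡ f 0 xs) → (∀ k xs → value t (k ∷ f k xs ∷ xs) ≡ f (suc k) xs) →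
          Computable (suc n)
primrec f s t base step = record
  { value   = λ xs → f (head xs) (tail xs)
  ; program = precᴿ (program s) (program t)
  ; correct = λ { (k ∷ xs) → run k xs }
  }
  where
  run : ∀ k xs → precᴿ (program s) (program t) [ k ∷ xs ]⇓ f k xs
  run zero    xs = ⇓prec-zero (subst (program s [ xs ]⇓_) (base xs) (correct s xs))
  run (suc k) xs =
    ⇓prec-suc (run k xs) (subst (program t [ _ ]⇓_) (step k xs) (correct t (k ∷ f k xs ∷ xs)))

successor : Computable 1
successor = record
  { value   = λ xs → suc (head xs)
  ; program = sucᴿ
  ; correct = λ { (x ∷ []) → ⇓suc }
  }

numeral : ℕ → Rec n
numeral zero    = compᴿ zeroᴿ []
numeral (suc k) = compᴿ sucᴿ (numeral k ∷ [])

numeral-correct : ∀ k (xs : Vec ℕ n) → numeral k [ xs ]⇓ k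
numeral-correct zero    xs = ⇓comp [] ⇓zero
numeral-correct (suc k) xs = ⇓comp (numeral-correct k xs ∷ []) ⇓suc

lit : ℕ → Computable n
lit k = record { value = λ _ → k ; program = numeral k ; correct = numeral-correct k }

infixl 6 _⊕_ _⊖_
infixl 7 _⊗_

_⊕_ _⊗_ _⊖_ : Computable n → Computable n → Computable n
_⊕_ = app₂ (primrec (λ k xs → k + lookup xs 0F) (var 0F) (app₁ successor (var 1F))
             (λ _ → refl) (λ _ _ → refl))
_⊗_ = app₂ (primrec (λ k xs → k * lookup xs 0F) (lit 0) (var 2F ⊕ var 1F)
             (λ _ → refl) (λ _ _ → refl))
-- The recursion runs on the first argument, which has to be the subtrahend; hence the exchanged
-- operands.
s ⊖ t = app₂ (primrec (λ k xs → lookup xs 0F ∸ k) (var 0F) (app₁ predecessor (var 1F))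
               (λ _ → refl) (λ k xs → pred[m∸n]≡m∸[1+n] (lookup xs 0F) k)) t s
  where
  predecessor : Computable 1
  predecessor = primrec (λ k _ → pred k) (lit 0) (var 0F) (λ _ → refl) (λ _ _ → refl)

power triangle parity : Computable n → Computable n
power = app₁ (primrec (λ k _ → 2 ^ k) (lit 1) (lit 2 ⊗ var 1F) (λ _ → refl) (λ _ _ → refl))
triangle = app₁ (primrec (λ k _ → triangular k) (lit 0) (app₁ successor (var 0F) ⊕ var 1F)
                  (λ _ → refl) (λ _ _ → refl))
parity = app₁ (primrec (λ k _ → 𝟙 (odd k)) (lit 0) (lit 1 ⊖ var 1F)
                (λ _ → refl) (λ k _ → sym (𝟙-not (odd k))))

digit pair : Computable n → Computable n → Computable n
digit s t = parity (app₂ (primrec (λ i xs → shift i (lookup xs 0F)) (var 0F) (app₁ halve (var 1F))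
                           (λ _ → refl) (λ _ _ → refl)) s t)
  where
  halve : Computable 1
  halve = primrec (λ k _ → half k) (lit 0) (var 1F ⊕ parity (var 0F)) (λ _ → refl) (λ _ _ → refl)
pair s t = triangle (s ⊕ t) ⊕ s

product : Computable n → Computable (suc n) → Computable n
product {n} s t = bind s
  (primrec (λ k xs → ∏< k (λ i → value t (i ∷ xs))) (lit 1) step (λ _ → refl) (λ _ _ → refl))
  where
  -- The recursion step sees the index, the partial product and then `xs`; the partial product must
  -- be skipped.
  factor : Computable (suc (suc n))
  factor = record
    { value   = λ xs → value t (head xs ∷ tail (tail xs))
    ; program = compᴿ (program t) (projᴿ 0F ∷ tabulate (λ i → projᴿ (suc (suc i))))
    ; correct = λ { xs@(_ ∷ _ ∷ ys) →
        ⇓comp (⇓proj 0F ∷ projections (λ i → suc (suc i)) xs ys (λ _ → refl)) (correct t _) }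
    }
  step : Computable (suc (suc n))
  step = var 1F ⊗ factor

-- The disjunction carries a decision of `P` along with the value, so that everything built below is
-- decided without excluded middle.
Characteristic : Set → ℕ → Set
Characteristic P v = (P × v ≡ 1) ⊎ (¬ P × v ≡ 0)

record Decision (n : ℕ) : Set₁ where
  field
    holds    : Vec ℕ n → Set
    χ        : Computable n
    reflects : ∀ xs → Characteristic (holds xs) (value χ xs)

open Decision

characteristic-¬ : ∀ {P v} → Characteristic P v → Characteristic (¬ P) (1 ∸ v)
characteristic-¬ (inj₁ (p  , refl)) = inj₂ ((λ ¬p → ¬p p) , refl)
characteristic-¬ (inj₂ (¬p , refl)) = inj₁ (¬p , refl)

module _ {P Q : Set} {v w : ℕ} where

  characteristic-× : Characteristic P v → Characteristic Q w → Characteristic (P × Q) (v * w)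
  characteristic-× (inj₁ (p  , refl)) (inj₁ (q  , refl)) = inj₁ ((p , q) , refl)
  characteristic-× (inj₁ (p  , refl)) (inj₂ (¬q , refl)) = inj₂ ((λ (_ , q) → ¬q q) , refl)
  characteristic-× (inj₂ (¬p , refl)) _                  = inj₂ ((λ (p , _) → ¬p p) , refl)

  characteristic-→ : Characteristic P v → Characteristic Q w →
                     Characteristic (P → Q) (1 ∸ v * (1 ∸ w))
  characteristic-→ (inj₁ (p  , refl)) (inj₁ (q  , refl)) = inj₁ ((λ _ → q) , refl)
  characteristic-→ (inj₁ (p  , refl)) (inj₂ (¬q , refl)) = inj₂ ((λ f → ¬q (f p)) , refl)
  characteristic-→ (inj₂ (¬p , refl)) _                  = inj₁ ((λ p → ⊥-elim (¬p p)) , refl)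

module _ {P : ℕ → Set} {f : ℕ → ℕ} (χ-P : ∀ i → Characteristic (P i) (f i)) where

  characteristic-∀ : ∀ k → Characteristic (∀ i → i < k → P i) (∏< k f)
  characteristic-∀ zero = inj₁ ((λ _ ()) , refl)
  characteristic-∀ (suc k) with characteristic-× (characteristic-∀ k) (χ-P k)
  ... | inj₂ (¬p , eq) = inj₂ ((λ all → ¬p ((λ i i<k → all i (m≤n⇒m≤1+n i<k)) , all k ≤-refl)) , eq)
  ... | inj₁ ((all , p) , eq) = inj₁ (all′ , eq)
    where
    all′ : ∀ i → i < suc k → P i
    all′ i i<1+k with m<1+n⇒m<n∨m≡n i<1+k
    ... | inj₁ i<k  = all i i<k
    ... | inj₂ refl = p

  -- A refuted universal statement yields no witness constructively, so the witness for `some<` is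
  -- found by running through the candidates.
  bounded-search : ∀ k → (∃[ i ] (i < k × P i)) ⊎ (∀ i → i < k → ¬ P i)
  bounded-search zero = inj₂ λ _ ()
  bounded-search (suc k) with bounded-search k | χ-P k
  ... | inj₁ (i , i<k , p) | _ = inj₁ (i , m≤n⇒m≤1+n i<k , p)
  ... | inj₂ none | inj₁ (p , _) = inj₁ (k , ≤-refl , p)
  ... | inj₂ none | inj₂ (¬p , _) = inj₂ none′
    where
    none′ : ∀ i → i < suc k → ¬ P i
    none′ i i<1+k with m<1+n⇒m<n∨m≡n i<1+k
    ... | inj₁ i<k  = none i i<k
    ... | inj₂ refl = ¬p

infix  5 _≐_
infixr 4 _∧ᵈ_
infixr 3 _⇒ᵈ_

-- Of the two truncated differences one is 0 and the other is the distance, so their sum vanishes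
-- exactly at equality.
_≐_ : Computable n → Computable n → Decision n
s ≐ t = record
  { holds    = λ xs → value s xs ≡ value t xs
  ; χ        = lit 1 ⊖ ((s ⊖ t) ⊕ (t ⊖ s))
  ; reflects = λ xs → characteristic-≡ (value s xs) (value t xs)
  }
  where
  characteristic-≡ : ∀ a b → Characteristic (a ≡ b) (1 ∸ ((a ∸ b) + (b ∸ a)))
  characteristic-≡ zero    zero    = inj₁ (refl , refl)
  characteristic-≡ zero    (suc b) = inj₂ ((λ ()) , 0∸n≡0 b)
  characteristic-≡ (suc a) zero    = inj₂ ((λ ()) , 0∸n≡0 (a + 0))
  characteristic-≡ (suc a) (suc b) with characteristic-≡ a b
  ... | inj₁ (eq , v) = inj₁ (cong suc eq , v)
  ... | inj₂ (ne , v) = inj₂ (ne ∘ suc-injective , v)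

¬ᵈ_ : Decision n → Decision n
¬ᵈ φ = record
  { holds    = λ xs → ¬ holds φ xs
  ; χ        = lit 1 ⊖ χ φ
  ; reflects = λ xs → characteristic-¬ (reflects φ xs)
  }

_∧ᵈ_ _⇒ᵈ_ : Decision n → Decision n → Decision n
φ ∧ᵈ ψ = record
  { holds    = λ xs → holds φ xs × holds ψ xs
  ; χ        = χ φ ⊗ χ ψ
  ; reflects = λ xs → characteristic-× (reflects φ xs) (reflects ψ xs)
  }
φ ⇒ᵈ ψ = record
  { holds    = λ xs → holds φ xs → holds ψ xs
  ; χ        = lit 1 ⊖ χ φ ⊗ (lit 1 ⊖ χ ψ)
  ; reflects = λ xs → characteristic-→ (reflects φ xs) (reflects ψ xs)
  }

all< some< : Computable n → Decision (suc n) → Decision n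
all< s φ = record
  { holds    = λ xs → ∀ i → i < value s xs → holds φ (i ∷ xs)
  ; χ        = product s (χ φ)
  ; reflects = λ xs → characteristic-∀ (λ i → reflects φ (i ∷ xs)) (value s xs)
  }
some< s φ = record
  { holds    = λ xs → ∃[ i ] (i < value s xs × holds φ (i ∷ xs))
  -- De Morgan: the product is 1 exactly when every instance fails.
  ; χ        = lit 1 ⊖ product s (lit 1 ⊖ χ φ)
  ; reflects = reflects-∃
  }
  where
  reflects-∃ : ∀ xs → Characteristic (∃[ i ] (i < value s xs × holds φ (i ∷ xs)))
                                     (1 ∸ ∏< (value s xs) (λ i → 1 ∸ value (χ φ) (i ∷ xs)))
  reflects-∃ xs with bounded-search (λ i → reflects φ (i ∷ xs)) (value s xs)
                   | characteristic-∀ (λ i → reflects (¬ᵈ φ) (i ∷ xs)) (value s xs)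
  ... | inj₁ ex@(i , i<k , p) | inj₁ (none , _) = ⊥-elim (none i i<k p)
  ... | inj₁ ex               | inj₂ (_ , eq)   = inj₁ (ex , cong (1 ∸_) eq)
  ... | inj₂ none             | inj₁ (_ , eq)   = inj₂ ((λ (i , i<k , p) → none i i<k p) , cong (1 ∸_) eq)
  ... | inj₂ none             | inj₂ (¬none , _) = ⊥-elim (¬none none)

-- `satisfiable` takes variables as parameters; this names a computed number so that it can be
-- passed on.
letᵈ : Computable n → Decision (suc n) → Decision n
letᵈ s φ = record
  { holds    = λ xs → holds φ (value s xs ∷ xs)
  ; χ        = bind s (χ φ)
  ; reflects = λ xs → reflects φ (value s xs ∷ xs)
  }

-- Binary digits and canonical indices

𝟙-injective : ∀ {b c} → 𝟙 b ≡ 𝟙 c → b ≡ c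
𝟙-injective {false} {false} _ = refl
𝟙-injective {true}  {true}  _ = refl

-- `shift` halves last; moving one halving to the front permits induction from the lowest digit
-- upwards.
bit-suc : ∀ i x → bit (suc i) x ≡ bit i (half x)
bit-suc i x = cong odd (shift-half i)
  where
  shift-half : ∀ i → half (shift i x) ≡ shift i (half x)
  shift-half zero    = refl
  shift-half (suc i) = cong half (shift-half i)

odd-double+ : ∀ m x → odd (2 * m + x) ≡ odd x
odd-double+ zero    x = refl
odd-double+ (suc m) x rewrite +-suc m (m + 0) =
  trans (Bool.not-involutive _) (odd-double+ m x)

half-double+ : ∀ m x → half (2 * m + x) ≡ m + half x
half-double+ zero    x = refl
half-double+ (suc m) x rewrite +-suc m (m + 0) = begin
  half (2 * m + x) + 𝟙 (odd (2 * m + x)) + 𝟙 (not (odd (2 * m + x)))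
    ≡⟨ +-assoc (half (2 * m + x)) _ _ ⟩
  half (2 * m + x) + (𝟙 (odd (2 * m + x)) + 𝟙 (not (odd (2 * m + x))))
    ≡⟨ cong₂ _+_ (half-double+ m x) (one (odd (2 * m + x))) ⟩
  m + half x + 1
    ≡⟨ +-comm _ 1 ⟩
  suc (m + half x) ∎
  where
  open ≡-Reasoning
  one : ∀ b → 𝟙 b + 𝟙 (not b) ≡ 1
  one false = refl
  one true  = refl

2*half+odd : ∀ x → 2 * half x + 𝟙 (odd x) ≡ x
2*half+odd zero = refl
2*half+odd (suc x) = begin
  2 * (half x + 𝟙 (odd x)) + 𝟙 (not (odd x))           ≡⟨ cong (_+ 𝟙 (not (odd x))) (*-distribˡ-+ 2 (half x) _) ⟩
  2 * half x + 2 * 𝟙 (odd x) + 𝟙 (not (odd x))         ≡⟨ +-assoc (2 * half x) _ _ ⟩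
  2 * half x + (2 * 𝟙 (odd x) + 𝟙 (not (odd x)))       ≡⟨ cong (2 * half x +_) (carry (odd x)) ⟩
  2 * half x + suc (𝟙 (odd x))                         ≡⟨ +-suc _ _ ⟩
  suc (2 * half x + 𝟙 (odd x))                         ≡⟨ cong suc (2*half+odd x) ⟩
  suc x ∎
  where
  open ≡-Reasoning
  carry : ∀ b → 2 * 𝟙 b + 𝟙 (not b) ≡ suc (𝟙 b)
  carry false = refl
  carry true  = refl

odd-𝟙 : ∀ b → odd (𝟙 b) ≡ b
odd-𝟙 false = refl
odd-𝟙 true  = refl

half-𝟙 : ∀ b → half (𝟙 b) ≡ 0
half-𝟙 false = refl
half-𝟙 true  = refl

half≤ : ∀ x → half x ≤ x
half≤ zero    = z≤n
half≤ (suc x) = ≤-trans (+-mono-≤ (half≤ x) (𝟙≤1 (odd x))) (≤-reflexive (+-comm x 1))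
  where
  𝟙≤1 : ∀ b → 𝟙 b ≤ 1
  𝟙≤1 false = z≤n
  𝟙≤1 true  = ≤-refl

half<suc : ∀ x → half (suc x) < suc x
half<suc zero    = s≤s z≤n
half<suc (suc x) = begin-strict
  half x + 𝟙 (odd x) + 𝟙 (not (odd x)) ≡⟨ half-double+ 1 x ⟩
  suc (half x)                         ≤⟨ s≤s (half≤ x) ⟩
  suc x                                <⟨ ≤-refl ⟩
  suc (suc x)                          ∎
  where open ≤-Reasoning

bit-zero : ∀ i → bit i 0 ≡ false
bit-zero zero    = refl
bit-zero (suc i) = trans (bit-suc i 0) (bit-zero i)

-- Halving makes a positive number smaller, so a set digit cannot sit at a position as large as the
-- number. Hence members of a coded set lie below its canonical index.
bit⇒< : ∀ i x → bit i x ≡ true → i < x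
bit⇒< i zero    p with () ← trans (sym (bit-zero i)) p
bit⇒< zero    (suc x) p = s≤s z≤n
bit⇒< (suc i) (suc x) p =
  <-≤-trans (s≤s (bit⇒< i (half (suc x)) (trans (sym (bit-suc i (suc x))) p))) (half<suc x)

bit-extensional : ∀ x y → (∀ i → bit i x ≡ bit i y) → x ≡ y
bit-extensional x y = bounded (x ⊔ y) x y (m≤m⊔n x y) (m≤n⊔m x y)
  where
  half≤pred : ∀ {x k} → x ≤ suc k → half x ≤ k
  half≤pred {zero}  _ = z≤n
  half≤pred {suc x} p = ≤-pred (≤-trans (half<suc x) p)

  bounded : ∀ k x y → x ≤ k → y ≤ k → (∀ i → bit i x ≡ bit i y) → x ≡ y
  bounded zero    x y z≤n z≤n _ = refl
  bounded (suc k) x y x≤k y≤k eq = begin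
    x                        ≡⟨ 2*half+odd x ⟨
    2 * half x + 𝟙 (odd x)   ≡⟨ cong₂ (λ h b → 2 * h + 𝟙 b) halves (eq 0) ⟩
    2 * half y + 𝟙 (odd y)   ≡⟨ 2*half+odd y ⟩
    y                        ∎
    where
    open ≡-Reasoning
    halves : half x ≡ half y
    halves = bounded k (half x) (half y) (half≤pred x≤k) (half≤pred y≤k)
      λ i → trans (sym (bit-suc i x)) (trans (eq (suc i)) (bit-suc i y))

fromBits : ∀ N (f : ℕ → Bool) → ∃[ t ] (t < 2 ^ N × ∀ i → i < N → bit i t ≡ f i)
fromBits zero    f = 0 , s≤s z≤n , λ _ ()
fromBits (suc N) f with t , t<2^N , bits ← fromBits N (f ∘ suc) = u , u<2^1+N , bits′
  where
  u : ℕ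
  u = 2 * t + 𝟙 (f 0)

  u<2^1+N : u < 2 ^ suc N
  u<2^1+N = begin-strict
    2 * t + 𝟙 (f 0)   <⟨ +-monoʳ-< (2 * t) (𝟙<2 (f 0)) ⟩
    2 * t + 2         ≡⟨ +-comm (2 * t) 2 ⟩
    2 + 2 * t         ≡⟨ *-suc 2 t ⟨
    2 * suc t         ≤⟨ *-monoʳ-≤ 2 t<2^N ⟩
    2 * 2 ^ N         ∎
    where
    open ≤-Reasoning
    𝟙<2 : ∀ b → 𝟙 b < 2
    𝟙<2 false = s≤s z≤n
    𝟙<2 true  = ≤-refl

  bits′ : ∀ i → i < suc N → bit i u ≡ f i
  bits′ zero    _ = trans (odd-double+ t (𝟙 (f 0))) (odd-𝟙 (f 0))
  bits′ (suc i) (s≤s i<N) = begin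
    bit (suc i) u              ≡⟨ bit-suc i u ⟩
    bit i (half u)             ≡⟨ cong (bit i) (half-double+ t (𝟙 (f 0))) ⟩
    bit i (t + half (𝟙 (f 0))) ≡⟨ cong (λ h → bit i (t + h)) (half-𝟙 (f 0)) ⟩
    bit i (t + 0)              ≡⟨ cong (bit i) (+-identityʳ t) ⟩
    bit i t                    ≡⟨ bits i i<N ⟩
    f (suc i)                  ∎
    where open ≡-Reasoning

_Indexes_ : ℕ → List ℕ → Set
x Indexes ns = ∀ i → bit i x ≡ true ⇔ i ∈ˡ ns

-- Where digit `d` is clear, adding `2 ^ d` causes no carry and the other digits stay. The recursion
-- halves until `d` is 0.
bit-2^+ : ∀ d x → bit d x ≡ false → ∀ i → bit i (2 ^ d + x) ≡ true ⇔ (i ≡ d ⊎ bit i x ≡ true)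
bit-2^+ zero    x even  zero    = mk⇔ (λ _ → inj₁ refl) (λ _ → cong not even)
bit-2^+ zero    x even  (suc i) = mk⇔ (λ p → inj₂ (trans (sym same) p)) λ { (inj₁ ()) ; (inj₂ p) → trans same p }
  where
  open ≡-Reasoning
  same : bit (suc i) (suc x) ≡ bit (suc i) x
  same = begin
    bit (suc i) (suc x)           ≡⟨ bit-suc i (suc x) ⟩
    bit i (half x + 𝟙 (odd x))    ≡⟨ cong (λ b → bit i (half x + 𝟙 b)) even ⟩
    bit i (half x + 0)            ≡⟨ cong (bit i) (+-identityʳ (half x)) ⟩
    bit i (half x)                ≡⟨ bit-suc i x ⟨
    bit (suc i) x                 ∎
bit-2^+ (suc d) x clear zero    = mk⇔ (λ p → inj₂ (trans (sym same) p)) λ { (inj₁ ()) ; (inj₂ p) → trans same p }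
  where
  same : odd (2 ^ suc d + x) ≡ odd x
  same = odd-double+ (2 ^ d) x
bit-2^+ (suc d) x clear (suc i) = mk⇔ (λ p → raise (to rec (trans (sym same) p)))
                                      (λ p → trans same (from rec (lower p)))
  where
  same : bit (suc i) (2 ^ suc d + x) ≡ bit i (2 ^ d + half x)
  same = trans (bit-suc i (2 ^ suc d + x)) (cong (bit i) (half-double+ (2 ^ d) x))
  rec : bit i (2 ^ d + half x) ≡ true ⇔ (i ≡ d ⊎ bit i (half x) ≡ true)
  rec = bit-2^+ d (half x) (trans (sym (bit-suc d x)) clear) i
  raise : i ≡ d ⊎ bit i (half x) ≡ true → suc i ≡ suc d ⊎ bit (suc i) x ≡ true
  raise (inj₁ refl) = inj₁ refl
  raise (inj₂ p)    = inj₂ (trans (bit-suc i x) p)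
  lower : suc i ≡ suc d ⊎ bit (suc i) x ≡ true → i ≡ d ⊎ bit i (half x) ≡ true
  lower (inj₁ refl) = inj₁ refl
  lower (inj₂ p)    = inj₂ (trans (sym (bit-suc i x)) p)

false⇔ : ∀ {b} {P : Set} → b ≡ true ⇔ P → ¬ P → b ≡ false
false⇔ {false} _ _  = refl
false⇔ {true}  e ¬p = ⊥-elim (¬p (to e refl))

2^+-indexes : ∀ {d x ns} → x Indexes ns → d ∉ˡ ns → (2 ^ d + x) Indexes (d ∷ ns)
2^+-indexes {d} {x} {ns} ix d∉ns i =
  mk⇔ (λ p → grow (to (bit-2^+ d x clear i) p)) (λ p → from (bit-2^+ d x clear i) (shrink p))
  where
  clear : bit d x ≡ false
  clear = false⇔ (ix d) d∉ns
  grow : i ≡ d ⊎ bit i x ≡ true → i ∈ˡ d ∷ ns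
  grow (inj₁ eq) = here eq
  grow (inj₂ p)  = there (to (ix i) p)
  shrink : i ∈ˡ d ∷ ns → i ≡ d ⊎ bit i x ≡ true
  shrink (here eq) = inj₁ eq
  shrink (there p) = inj₂ (from (ix i) p)

sum-indexes : ∀ {ns} → Unique ns → sum (map (2 ^_) ns) Indexes ns
sum-indexes []           i = mk⇔ (λ p → ⊥-elim (n≮0 (bit⇒< i 0 p))) λ ()
sum-indexes (x∉ns ∷ uns) = 2^+-indexes (sum-indexes uns) (All¬⇒¬Any x∉ns)

canonicalIndex-indexes : ∀ ns → canonicalIndex ns Indexes ns
canonicalIndex-indexes ns i =
  mk⇔ (λ p → ∈-deduplicate⁻ _≟_ ns (to unique p)) (λ p → from unique (∈-deduplicate⁺ _≟_ p))
  where unique = sum-indexes (deduplicate-! _≟_ ns) i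

-- The factor is 0 if `d` is already a member; this turns the case distinction into arithmetic that
-- `consequence` can express.
insert : ℕ → ℕ → ℕ
insert d x = 2 ^ d * (1 ∸ 𝟙 (bit d x)) + x

insert-indexes : ∀ {d x ns} → x Indexes ns → insert d x Indexes (d ∷ ns)
insert-indexes {d} {x} {ns} ix with bit d x in eq
... | false rewrite *-identityʳ (2 ^ d) =
  2^+-indexes ix λ d∈ns → Bool.not-¬ eq (from (ix d) d∈ns)
... | true  rewrite *-zeroʳ (2 ^ d) = λ i →
  mk⇔ (there ∘ to (ix i)) (λ { (here refl) → eq ; (there p) → from (ix i) p })

members : ℕ → List ℕ
members x = filter (λ i → bit i x Bool.≟ true) (upTo x)

canonicalIndex-members : ∀ x → canonicalIndex (members x) ≡ x
canonicalIndex-members x = bit-extensional _ _ λ i → same (trans-⇔ i)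
  where
  same : ∀ {b c} → b ≡ true ⇔ c ≡ true → b ≡ c
  same {c = false} e = false⇔ e λ ()
  same {c = true}  e = from e refl
  trans-⇔ : ∀ i → bit i (canonicalIndex (members x)) ≡ true ⇔ bit i x ≡ true
  trans-⇔ i = mk⇔
    (λ p → proj₂ (∈-filter⁻ _ {xs = upTo x} (to (canonicalIndex-indexes (members x) i) p)))
    (λ p → from (canonicalIndex-indexes (members x) i) (∈-filter⁺ _ (∈-upTo⁺ (bit⇒< i x p)) p))

-- Cantor pairing and codes of formulas

-- The successor in Cantor's order, along an antidiagonal and then to the start of the following
-- one; iterating it inverts the pairing.
next : ℕ × ℕ → ℕ × ℕ
next (m , zero)  = 0 , suc m
next (m , suc n) = suc m , n

unpair : ℕ → ℕ × ℕ
unpair zero    = 0 , 0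
unpair (suc p) = next (unpair p)

pair-next : ∀ q → uncurry ⟨_,_⟩ (next q) ≡ suc (uncurry ⟨_,_⟩ q)
pair-next (m , zero)  rewrite +-identityʳ m | +-identityʳ (m + triangular m) = cong suc (+-comm m _)
pair-next (m , suc n) rewrite +-suc m n = +-suc _ m

pair-unpair : ∀ p → uncurry ⟨_,_⟩ (unpair p) ≡ p
pair-unpair zero    = refl
pair-unpair (suc p) = trans (pair-next (unpair p)) (cong suc (pair-unpair p))

-- Induction on the code: every pair other than `(0 , 0)` is `next` of the pair just before it.
unpair-pair : ∀ m n → unpair ⟨ m , n ⟩ ≡ (m , n)
unpair-pair m n = invert ⟨ m , n ⟩ m n refl
  where
  invert : ∀ p m n → ⟨ m , n ⟩ ≡ p → unpair p ≡ (m , n)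
  invert zero    zero    zero    _  = refl
  invert (suc p) zero    (suc n) eq =
    cong next (invert p n 0 (suc-injective (trans (sym (pair-next (n , 0))) eq)))
  invert (suc p) (suc m) n       eq =
    cong next (invert p m (suc n) (suc-injective (trans (sym (pair-next (m , suc n))) eq)))

m≤⟨m,n⟩ : ∀ m n → m ≤ ⟨ m , n ⟩
m≤⟨m,n⟩ m n = m≤n+m m (triangular (m + n))

n≤⟨m,n⟩ : ∀ m n → n ≤ ⟨ m , n ⟩
n≤⟨m,n⟩ m n = ≤-trans (m≤n+m n m) (≤-trans (n≤triangular (m + n)) (m≤m+n _ m))
  where
  n≤triangular : ∀ n → n ≤ triangular n
  n≤triangular zero    = z≤n
  n≤triangular (suc n) = m≤m+n (suc n) (triangular n)

pair-injective : ∀ {m n m′ n′} → ⟨ m , n ⟩ ≡ ⟨ m′ , n′ ⟩ → (m , n) ≡ (m′ , n′)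
pair-injective {m} {n} {m′} {n′} eq =
  trans (sym (unpair-pair m n)) (trans (cong unpair eq) (unpair-pair m′ n′))

-- Components have smaller codes than the compound; this keeps the fuel of `parse` sufficient and
-- subformulas within the bound `N`.
subcode : ∀ {x q} r → x ≤ q → x < suc r + 5 * q
subcode {x} {q} r x≤q = s≤s (≤-trans x≤q (≤-trans (m≤n*m q 5) (m≤n+m (5 * q) r)))

build : (ℕ → Formula) → ℕ → ℕ → Formula
build p 0 q = X q
build p 1 q = ¬′ p q
build p 2 q = p (proj₁ (unpair q)) ∧′ p (proj₂ (unpair q))
build p 3 q = p (proj₁ (unpair q)) ∨′ p (proj₂ (unpair q))
-- Reached from `parse` only with tag 4, since the tag is a remainder modulo 5.
build p _ q = p (proj₁ (unpair q)) ⇒′ p (proj₂ (unpair q))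

-- The first argument is fuel; it suffices that it exceeds the code.
parse : ℕ → ℕ → Formula
parse zero    _ = X 0
parse (suc k) c = build (parse k) (c % 5) (c / 5)

code-parse : ∀ k c → c < k → codeFormula (parse k c) ≡ c
code-parse (suc k) c (s≤s c≤k) =
  code-build (c % 5) (c / 5) (m%n<n c 5)
    (trans (m≡m%n+[m/n]*n c 5) (cong (c % 5 +_) (*-comm (c / 5) 5)))
  where
  code-parts : ∀ r q → c ≡ suc r + 5 * q →
    ⟨ codeFormula (parse k (proj₁ (unpair q))) , codeFormula (parse k (proj₂ (unpair q))) ⟩ ≡ q
  code-parts r q eq = trans
    (cong₂ ⟨_,_⟩
      (code-parse k _ (smaller (subst (a ≤_) (pair-unpair q) (m≤⟨m,n⟩ a b))))
      (code-parse k _ (smaller (subst (b ≤_) (pair-unpair q) (n≤⟨m,n⟩ a b)))))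
    (pair-unpair q)
    where
    a b : ℕ
    a = proj₁ (unpair q)
    b = proj₂ (unpair q)
    smaller : ∀ {x} → x ≤ q → x < k
    smaller x≤q = <-≤-trans (subcode r x≤q) (≤-trans (≤-reflexive (sym eq)) c≤k)

  code-build : ∀ r q → r < 5 → c ≡ r + 5 * q → codeFormula (build (parse k) r q) ≡ c
  code-build 0 q _ eq = sym eq
  code-build 1 q _ eq = trans (cong (λ z → 1 + 5 * z) (code-parse k q q<k)) (sym eq)
    where
    q<k : q < k
    q<k = <-≤-trans (subcode 0 ≤-refl) (≤-trans (≤-reflexive (sym eq)) c≤k)
  code-build 2 q _ eq = trans (cong (λ z → 2 + 5 * z) (code-parts 1 q eq)) (sym eq)
  code-build 3 q _ eq = trans (cong (λ z → 3 + 5 * z) (code-parts 2 q eq)) (sym eq)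
  code-build 4 q _ eq = trans (cong (λ z → 4 + 5 * z) (code-parts 3 q eq)) (sym eq)
  code-build (suc (suc (suc (suc (suc _))))) q (s≤s (s≤s (s≤s (s≤s (s≤s ()))))) eq

parse-code : ∀ k A → codeFormula A < k → parse k (codeFormula A) ≡ A
parse-code (suc k) A (s≤s A≤k) = unbuild A A≤k
  where
  parse-step : ∀ r q → r < 5 → parse (suc k) (r + 5 * q) ≡ build (parse k) r q
  parse-step r q r<5 = cong₂ (build (parse k)) remainder quotient
    where
    remainder : (r + 5 * q) % 5 ≡ r
    remainder = trans (cong (λ z → (r + z) % 5) (*-comm 5 q))
                      (trans ([m+kn]%n≡m%n r q 5) (m<n⇒m%n≡m r<5))
    quotient : (r + 5 * q) / 5 ≡ q
    quotient = trans (cong (λ z → (r + z) / 5) (*-comm 5 q))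
                     (trans (+-distrib-/-∣ʳ r (divides-refl q))
                            (cong₂ _+_ (m<n⇒m/n≡0 r<5) (m*n/n≡m q 5)))

  parse-pair : ∀ r A B → suc r + 5 * ⟨ codeFormula A , codeFormula B ⟩ ≤ k →
    parse k (proj₁ (unpair ⟨ codeFormula A , codeFormula B ⟩)) ≡ A ×
    parse k (proj₂ (unpair ⟨ codeFormula A , codeFormula B ⟩)) ≡ B
  parse-pair r A B c≤k rewrite unpair-pair (codeFormula A) (codeFormula B) =
    parse-code k A (<-≤-trans (subcode r (m≤⟨m,n⟩ (codeFormula A) (codeFormula B))) c≤k) ,
    parse-code k B (<-≤-trans (subcode r (n≤⟨m,n⟩ (codeFormula A) (codeFormula B))) c≤k)

  unbuild : ∀ A → codeFormula A ≤ k → parse (suc k) (codeFormula A) ≡ A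
  unbuild (X n)    _ = parse-step 0 n (s≤s z≤n)
  unbuild (¬′ A)   c≤k = trans (parse-step 1 (codeFormula A) (m≤m+n 2 3))
    (cong ¬′_ (parse-code k A (<-≤-trans (subcode 0 ≤-refl) c≤k)))
  unbuild (A ∧′ B) c≤k with p , q ← parse-pair 1 A B c≤k =
    trans (parse-step 2 ⟨ codeFormula A , codeFormula B ⟩ (m≤m+n 3 2)) (cong₂ _∧′_ p q)
  unbuild (A ∨′ B) c≤k with p , q ← parse-pair 2 A B c≤k =
    trans (parse-step 3 ⟨ codeFormula A , codeFormula B ⟩ (m≤m+n 4 1)) (cong₂ _∨′_ p q)
  unbuild (A ⇒′ B) c≤k with p , q ← parse-pair 3 A B c≤k =
    trans (parse-step 4 ⟨ codeFormula A , codeFormula B ⟩ (m≤m+n 5 0)) (cong₂ _⇒′_ p q)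

decode : ℕ → Formula
decode c = parse (suc c) c

code-decode : ∀ c → codeFormula (decode c) ≡ c
code-decode c = code-parse (suc c) c ≤-refl

decode-code : ∀ A → decode (codeFormula A) ≡ A
decode-code A = parse-code _ A ≤-refl

codeFormula-injective : ∀ {A B} → codeFormula A ≡ codeFormula B → A ≡ B
codeFormula-injective {A} {B} eq = trans (sym (decode-code A)) (trans (cong decode eq) (decode-code B))

codeFormula-surjective : ∀ c → ∃[ A ] codeFormula A ≡ c
codeFormula-surjective c = decode c , code-decode c

odd-double : ∀ p → odd (2 * p) ≡ false
odd-double p = trans (cong odd (sym (+-identityʳ (2 * p)))) (odd-double+ p 0)

codeFormulas-surjective : ∀ q → ∃[ A ] ∃[ B ] ⟨ codeFormula A , codeFormula B ⟩ ≡ q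
codeFormulas-surjective q =
  decode (proj₁ (unpair q)) , decode (proj₂ (unpair q)) ,
  trans (cong₂ ⟨_,_⟩ (code-decode (proj₁ (unpair q))) (code-decode (proj₂ (unpair q)))) (pair-unpair q)

codeSFormula-surjective : ∀ s → ∃[ φ ] codeSFormula φ ≡ s
codeSFormula-surjective s with codeFormulas-surjective (half s) | odd s | 2*half+odd s
... | A , B , eq | false | s≡ = A ≺ B , trans (cong (2 *_) eq) (trans (sym (+-identityʳ _)) s≡)
... | A , B , eq | true  | s≡ = A ⊀ B , trans (cong (λ q → suc (2 * q)) eq) (trans (+-comm 1 _) s≡)

codeSFormula-injective : ∀ {φ ψ} → codeSFormula φ ≡ codeSFormula ψ → φ ≡ ψ
codeSFormula-injective {A ≺ B} {C ≺ D} eq =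
  cong₂ _≺_ (codeFormula-injective (cong proj₁ parts)) (codeFormula-injective (cong proj₂ parts))
  where parts = pair-injective (*-cancelˡ-≡ _ _ 2 eq)
codeSFormula-injective {A ⊀ B} {C ⊀ D} eq =
  cong₂ _⊀_ (codeFormula-injective (cong proj₁ parts)) (codeFormula-injective (cong proj₂ parts))
  where parts = pair-injective (*-cancelˡ-≡ _ _ 2 (suc-injective eq))
codeSFormula-injective {A ≺ B} {C ⊀ D} eq =
  ⊥-elim (even≢odd ⟨ codeFormula A , codeFormula B ⟩ ⟨ codeFormula C , codeFormula D ⟩ eq)
codeSFormula-injective {A ⊀ B} {C ≺ D} eq =
  ⊥-elim (even≢odd ⟨ codeFormula C , codeFormula D ⟩ ⟨ codeFormula A , codeFormula B ⟩ (sym eq))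

-- Strict negation and the arithmetized decision

negate : SFormula → SFormula
negate (A ≺ B) = A ⊀ B
negate (A ⊀ B) = A ≺ B

-- Codes of `≺` are even and codes of `⊀` are odd; negation moves an even code up by one and an odd
-- code down by one.
flip : ℕ → ℕ
flip s = suc s ∸ 2 * 𝟙 (odd s)

code-negate : ∀ φ → codeSFormula (negate φ) ≡ flip (codeSFormula φ)
code-negate (A ≺ B) rewrite odd-double ⟨ codeFormula A , codeFormula B ⟩ = refl
code-negate (A ⊀ B) rewrite odd-double ⟨ codeFormula A , codeFormula B ⟩ = refl

-- t is a truth table for the formulas with codes below N: its bit at a code is the truth value.
consistent : Fin n → Fin n → Decision n
consistent N t =
  all< (var N) (all< (var (suc N)) (all< (var (suc (suc N)))
    ( (c ≐ lit 1 ⊕ lit 5 ⊗ a        ⇒ᵈ digit c t′ ≐ lit 1 ⊖ digit a t′)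
   ∧ᵈ (c ≐ lit 2 ⊕ lit 5 ⊗ pair a b ⇒ᵈ digit c t′ ≐ digit a t′ ⊗ digit b t′)
   ∧ᵈ (c ≐ lit 3 ⊕ lit 5 ⊗ pair a b ⇒ᵈ
        digit c t′ ≐ lit 1 ⊖ (lit 1 ⊖ digit a t′) ⊗ (lit 1 ⊖ digit b t′))
   ∧ᵈ (c ≐ lit 4 ⊕ lit 5 ⊗ pair a b ⇒ᵈ
        digit c t′ ≐ lit 1 ⊖ digit a t′ ⊗ (lit 1 ⊖ digit b t′)))))
  where
  a b c t′ : Computable _
  a  = var 2F
  b  = var 1F
  c  = var 0F
  t′ = var (suc (suc (suc t)))

counterexample : Fin n → Fin n → Fin n → Computable n
counterexample x y t = digit (var x) (var t) ⊗ (lit 1 ⊖ digit (var y) (var t))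

model : Fin n → Fin n → Fin n → Decision n
model N c t =
  consistent N t ∧ᵈ
  all< (var N) (all< (var (suc N))
    -- `2 * ⟨ x , y ⟩` codes the strict implication between the formulas with codes `x` and `y`; if
    -- the theory contains it, `t` must not be a counterexample.
    (digit (lit 2 ⊗ pair (var 1F) (var 0F)) (var (suc (suc c))) ≐ lit 1 ⇒ᵈ
     counterexample 1F 0F (suc (suc t)) ≐ lit 0))

-- c is the canonical index of the theory.
satisfiable : Fin n → Fin n → Decision n
satisfiable N c =
  some< (power (var N)) (model (suc N) (suc c) 0F) ∧ᵈ
  all< (var N) (all< (var (suc N))
    (digit (lit 1 ⊕ lit 2 ⊗ pair (var 1F) (var 0F)) (var (suc (suc c))) ≐ lit 1 ⇒ᵈ
     some< (power (var (suc (suc N))))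
       (model (suc (suc (suc N))) (suc (suc (suc c))) 0F ∧ᵈ counterexample 2F 1F 0F ≐ lit 1)))

-- The components of a pair never exceed its code, so a bounded search can unpair the input.
consequence : Decision 1
consequence =
  some< (lit 1 ⊕ var 0F) (some< (lit 1 ⊕ var 1F)
    (pair (var 1F) (var 0F) ≐ var 2F ∧ᵈ
     -- The negated conclusion is coded and inserted into the theory; the bound is the input plus
     -- one, above the codes of all formulas related by members of the enlarged theory.
     letᵈ (flipᶜ (var 0F)) (letᵈ (insertᶜ (var 0F) (var 2F)) (letᵈ (lit 1 ⊕ var 4F)
       (¬ᵈ satisfiable 0F 1F)))))
  where
  flipᶜ : Computable n → Computable n
  flipᶜ s = lit 1 ⊕ s ⊖ lit 2 ⊗ parity s
  insertᶜ : Computable n → Computable n → Computable n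
  insertᶜ d x = power d ⊗ (lit 1 ⊖ digit d x) ⊕ x

-- The environment holds just the parameters. As `holds` computes, the occurrences inside
-- `satisfiable` and `consequence` reduce to these same propositions.
Consistent : ℕ → ℕ → Set
Consistent N t = holds (consistent 0F 1F) (N ∷ t ∷ [])

Model : ℕ → ℕ → ℕ → Set
Model N c t = holds (model 0F 1F 2F) (N ∷ c ∷ t ∷ [])

Satisfiableᶜ : ℕ → ℕ → Set
Satisfiableᶜ N c = holds (satisfiable 0F 1F) (N ∷ c ∷ [])

-- Truth tables and valuations

𝟙-∧ : ∀ a b → 𝟙 (a ∧ b) ≡ 𝟙 a * 𝟙 b
𝟙-∧ false b     = refl
𝟙-∧ true  b     = sym (+-identityʳ (𝟙 b))

𝟙-∨ : ∀ a b → 𝟙 (a ∨ b) ≡ 1 ∸ (1 ∸ 𝟙 a) * (1 ∸ 𝟙 b)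
𝟙-∨ true  b     = refl
𝟙-∨ false false = refl
𝟙-∨ false true  = refl

𝟙-⇒ : ∀ a b → 𝟙 (not a ∨ b) ≡ 1 ∸ 𝟙 a * (1 ∸ 𝟙 b)
𝟙-⇒ false b     = refl
𝟙-⇒ true  false = refl
𝟙-⇒ true  true  = refl

-- `consistent` has no clause for variables, so the bits at their codes are free and serve as the
-- valuation.
valuation : ℕ → Valuation
valuation t n = bit (codeFormula (X n)) t

-- By induction on the formula: subformulas have smaller codes, so the bounded clauses of
-- `consistent` reach them and force the truth-functional values.
consistent-evaluates : ∀ {N t} → Consistent N t →
  ∀ A → codeFormula A < N → bit (codeFormula A) t ≡ ⟦ A ⟧ (valuation t)
consistent-evaluates {N} {t} con = go
  where
  binary : (r : ℕ) (A B : Formula) → suc r + 5 * ⟨ codeFormula A , codeFormula B ⟩ < N →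
           codeFormula A < N × codeFormula B < N
  binary r A B c<N =
    <-trans (subcode r (m≤⟨m,n⟩ (codeFormula A) (codeFormula B))) c<N ,
    <-trans (subcode r (n≤⟨m,n⟩ (codeFormula A) (codeFormula B))) c<N

  go : ∀ A → codeFormula A < N → bit (codeFormula A) t ≡ ⟦ A ⟧ (valuation t)
  go (X n)    c<N = refl
  go (¬′ A)   c<N = 𝟙-injective
    (trans (proj₁ (con _ a<N _ a<N _ c<N) refl)
    (trans (cong (λ x → 1 ∸ 𝟙 x) (go A a<N)) (sym (𝟙-not (⟦ A ⟧ (valuation t))))))
    where a<N = <-trans (subcode 0 ≤-refl) c<N
  go (A ∧′ B) c<N with a<N , b<N ← binary 1 A B c<N = 𝟙-injective
    (trans (proj₁ (proj₂ (con _ a<N _ b<N _ c<N)) refl)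
    (trans (cong₂ (λ x y → 𝟙 x * 𝟙 y) (go A a<N) (go B b<N)) (sym (𝟙-∧ (⟦ A ⟧ _) _))))
  go (A ∨′ B) c<N with a<N , b<N ← binary 2 A B c<N = 𝟙-injective
    (trans (proj₁ (proj₂ (proj₂ (con _ a<N _ b<N _ c<N))) refl)
    (trans (cong₂ (λ x y → 1 ∸ (1 ∸ 𝟙 x) * (1 ∸ 𝟙 y)) (go A a<N) (go B b<N)) (sym (𝟙-∨ (⟦ A ⟧ _) _))))
  go (A ⇒′ B) c<N with a<N , b<N ← binary 3 A B c<N = 𝟙-injective
    (trans (proj₂ (proj₂ (proj₂ (con _ a<N _ b<N _ c<N))) refl)
    (trans (cong₂ (λ x y → 1 ∸ 𝟙 x * (1 ∸ 𝟙 y)) (go A a<N) (go B b<N)) (sym (𝟙-⇒ (⟦ A ⟧ _) _))))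

-- Every number is the code of a formula, so decoding prescribes each digit of `t`; the clauses of
-- `consistent` hold because evaluation obeys them.
truthTable : ∀ N w → ∃[ t ] (t < 2 ^ N × Consistent N t ×
                             ∀ A → codeFormula A < N → bit (codeFormula A) t ≡ ⟦ A ⟧ w)
truthTable N w with t , t<2^N , bits ← fromBits N (λ c → ⟦ decode c ⟧ w) = t , t<2^N , con , table
  where
  table : ∀ A → codeFormula A < N → bit (codeFormula A) t ≡ ⟦ A ⟧ w
  table A A<N = trans (bits _ A<N) (cong (λ B → ⟦ B ⟧ w) (decode-code A))

  con : Consistent N t
  con a a<N b b<N c c<N with codeFormula-surjective a | codeFormula-surjective b
  ... | A , refl | B , refl =
    (λ { refl → trans (cong 𝟙 (table (¬′ A) c<N))
                      (trans (𝟙-not (⟦ A ⟧ w)) (cong (λ x → 1 ∸ 𝟙 x) (sym (table A a<N)))) }) ,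
    (λ { refl → trans (cong 𝟙 (table (A ∧′ B) c<N)) (trans (𝟙-∧ (⟦ A ⟧ w) _)
                      (cong₂ (λ x y → 𝟙 x * 𝟙 y) (sym (table A a<N)) (sym (table B b<N)))) }) ,
    (λ { refl → trans (cong 𝟙 (table (A ∨′ B) c<N)) (trans (𝟙-∨ (⟦ A ⟧ w) _)
                      (cong₂ (λ x y → 1 ∸ (1 ∸ 𝟙 x) * (1 ∸ 𝟙 y)) (sym (table A a<N)) (sym (table B b<N)))) }) ,
    (λ { refl → trans (cong 𝟙 (table (A ⇒′ B) c<N)) (trans (𝟙-⇒ (⟦ A ⟧ w) _)
                      (cong₂ (λ x y → 1 ∸ 𝟙 x * (1 ∸ 𝟙 y)) (sym (table A a<N)) (sym (table B b<N)))) })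

-- Satisfiability of finite theories

infix 4 _⊩ˡ_

_⊩ˡ_ : Frame → List SFormula → Set
R ⊩ˡ ψs = R ⊩ᵗ (_∈ˡ ψs)

CodedBelow : ℕ → SFormula → Set
CodedBelow N (A ≺ B) = codeFormula A < N × codeFormula B < N
CodedBelow N (A ⊀ B) = codeFormula A < N × codeFormula B < N

implication⁺ : ∀ {a b} → a ≡ false ⊎ b ≡ true → 𝟙 a * (1 ∸ 𝟙 b) ≡ 0
implication⁺ (inj₁ refl) = refl
implication⁺ {a} (inj₂ refl) = *-zeroʳ (𝟙 a)

implication⁻ : ∀ a b → 𝟙 a * (1 ∸ 𝟙 b) ≡ 0 → a ≡ false ⊎ b ≡ true
implication⁻ false b    _ = inj₁ refl
implication⁻ true  true _ = inj₂ refl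

nonimplication⁻ : ∀ a b → 𝟙 a * (1 ∸ 𝟙 b) ≡ 1 → a ≡ true × b ≡ false
nonimplication⁻ true false _ = refl , refl

module _ {N c ψs} (c-indexes : ∀ ψ → bit (codeSFormula ψ) c ≡ true ⇔ ψ ∈ˡ ψs)
         (below : ∀ {ψ} → ψ ∈ˡ ψs → CodedBelow N ψ) where

  private
    -- The largest candidate frame: every frame satisfying the list is contained in it.
    Implications : Pred Valuation _
    Implications w = ∀ A B → A ≺ B ∈ˡ ψs → ⟦ A ⟧ w ≡ false ⊎ ⟦ B ⟧ w ≡ true

  model-valuation : ∀ {t} → Model N c t → valuation t ∈ Implications
  model-valuation {t} (con , imps) A B ∈ψs with A<N , B<N ← below ∈ψs =
    subst₂ (λ a b → a ≡ false ⊎ b ≡ true)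
      (consistent-evaluates con A A<N) (consistent-evaluates con B B<N)
      (implication⁻ _ _ (imps _ A<N _ B<N (cong 𝟙 (from (c-indexes (A ≺ B)) ∈ψs))))

  truthTable-model : ∀ {w} → w ∈ Implications →
    ∃[ t ] (t < 2 ^ N × Model N c t × ∀ A → codeFormula A < N → bit (codeFormula A) t ≡ ⟦ A ⟧ w)
  truthTable-model {w} imps with t , t< , con , table ← truthTable N w = t , t< , (con , respects) , table
    where
    respects : ∀ x → x < N → ∀ y → y < N → 𝟙 (bit (2 * ⟨ x , y ⟩) c) ≡ 1 →
               𝟙 (bit x t) * (1 ∸ 𝟙 (bit y t)) ≡ 0
    respects x x<N y y<N ∈c with codeFormula-surjective x | codeFormula-surjective y
    ... | A , refl | B , refl =
      trans (cong₂ (λ a b → 𝟙 a * (1 ∸ 𝟙 b)) (table A x<N) (table B y<N))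
            (implication⁺ (imps A B (to (c-indexes (A ≺ B)) (𝟙-injective {c = true} ∈c))))

  -- The frame is `Implications`: the first conjunct of satisfiability makes it nonempty, the second
  -- puts a witness of each strict nonimplication into it.
  satisfiable-sound : Satisfiableᶜ N c → ∃[ R ] R ⊩ˡ ψs
  satisfiable-sound ((t₀ , _ , m₀) , nonimps) = R , forces
    where
    R : Frame
    R = Implications , valuation t₀ , model-valuation m₀
    forces : R ⊩ˡ ψs
    forces (A ≺ B) ∈ψs = λ w imps → imps A B ∈ψs
    forces (A ⊀ B) ∈ψs with A<N , B<N ← below ∈ψs
      with t , _ , m , eq ← nonimps _ A<N _ B<N (cong 𝟙 (from (c-indexes (A ⊀ B)) ∈ψs))
      with a , b ← nonimplication⁻ _ _ eq =
      valuation t , model-valuation m ,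
      trans (sym (consistent-evaluates (proj₁ m) A A<N)) a ,
      trans (sym (consistent-evaluates (proj₁ m) B B<N)) b

  -- Truth tables of valuations in `R` are models: any one of them gives the first conjunct, those
  -- of the witnesses of strict nonimplications give the second.
  satisfiable-complete : ∀ R → R ⊩ˡ ψs → Satisfiableᶜ N c
  satisfiable-complete R@(P , w₀ , w₀∈R) forces
    with t , t< , m , _ ← truthTable-model (λ A B ∈ψs → forces (A ≺ B) ∈ψs w₀ w₀∈R) = (t , t< , m) , nonimps
    where
    nonimps : ∀ x → x < N → ∀ y → y < N → 𝟙 (bit (1 + 2 * ⟨ x , y ⟩) c) ≡ 1 →
              ∃[ t ] (t < 2 ^ N × Model N c t × 𝟙 (bit x t) * (1 ∸ 𝟙 (bit y t)) ≡ 1)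
    nonimps x x<N y y<N ∈c with codeFormula-surjective x | codeFormula-surjective y
    ... | A , refl | B , refl
      with w , w∈R , a , b ← forces (A ⊀ B) (to (c-indexes (A ⊀ B)) (𝟙-injective {c = true} ∈c))
      with t , t< , m , table ← truthTable-model (λ A B ∈ψs → forces (A ≺ B) ∈ψs w w∈R) =
      t , t< , m , cong₂ (λ a b → 𝟙 a * (1 ∸ 𝟙 b)) (trans (table A x<N) a) (trans (table B y<N) b)

⊩-negate : ∀ R φ → R ⊩ φ → ¬ R ⊩ negate φ
⊩-negate R (A ≺ B) f (w , w∈R , a , b) with f w w∈R
... | inj₁ a′ = Bool.not-¬ a a′
... | inj₂ b′ = Bool.not-¬ b b′
⊩-negate R (A ⊀ B) (w , w∈R , a , b) f with f w w∈R
... | inj₁ a′ = Bool.not-¬ a a′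
... | inj₂ b′ = Bool.not-¬ b b′

-- A frame need not be decidable, but finitely many of its valuations witness the strict
-- nonimplications of a finite theory, and a finite frame can be searched.
witnesses : ∀ (R : Frame) ψs → R ⊩ˡ ψs →
  ∃[ ws ] (All (proj₁ R) ws × ∀ A B → A ⊀ B ∈ˡ ψs → ∃[ w ] (w ∈ˡ ws × ⟦ A ⟧ w ≡ true × ⟦ B ⟧ w ≡ false))
witnesses R []       f = [] , [] , λ _ _ ()
witnesses R (ψ ∷ ψs) f with witnesses R ψs (λ χ p → f χ (there p)) | ψ | f ψ (here refl)
... | ws , ws⊆R , wit | A ≺ B | _ = ws , ws⊆R , λ { C D (there p) → wit C D p }
... | ws , ws⊆R , wit | A ⊀ B | w , w∈R , a , b = w ∷ ws , w∈R ∷ ws⊆R , λ where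
  C D (here refl) → w , here refl , a , b
  C D (there p)   → let v , v∈ws , cd = wit C D p in v , there v∈ws , cd

finiteSubframe : ∀ R ψs → R ⊩ˡ ψs →
  ∃[ ws ] (All (proj₁ R) ws × ∃[ w∈ws ] ((_∈ˡ ws) , w∈ws) ⊩ˡ ψs)
finiteSubframe R@(P , w₀ , w₀∈R) ψs f with ws , ws⊆R , wit ← witnesses R ψs f =
  -- `w₀` keeps the frame nonempty when the theory has no strict nonimplication.
  w₀ ∷ ws , w₀∈R ∷ ws⊆R , (w₀ , here refl) , forces
  where
  forces : ((_∈ˡ w₀ ∷ ws) , w₀ , here refl) ⊩ˡ ψs
  forces (A ≺ B) ∈ψs = λ w w∈ → f (A ≺ B) ∈ψs w (All.lookup (w₀∈R ∷ ws⊆R) w∈)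
  forces (A ⊀ B) ∈ψs = let w , w∈ , ab = wit A B ∈ψs in w , there w∈ , ab

⊩ˡ-∷ : ∀ R {ψ ψs} → R ⊩ ψ → R ⊩ˡ ψs → R ⊩ˡ ψ ∷ ψs
⊩ˡ-∷ R p ps _ (here refl) = p
⊩ˡ-∷ R p ps _ (there q)   = ps _ q

-- For `≺`, a failing valuation would make `R` satisfy the negation. For `⊀`, a witness must be
-- produced without excluded middle: a finite subframe is searched, and if the search fails this
-- subframe satisfies `A ≺ B`, against unsatisfiability.
refutation : ∀ φ ψs → ¬ (∃[ R ] R ⊩ˡ negate φ ∷ ψs) → ∀ R → R ⊩ˡ ψs → R ⊩ φ
refutation (A ≺ B) ψs unsat R f w w∈R with ⟦ A ⟧ w in a | ⟦ B ⟧ w in b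
... | false | _     = inj₁ refl
... | true  | true  = inj₂ refl
... | true  | false = ⊥-elim (unsat (R , ⊩ˡ-∷ R (w , w∈R , a , b) f))
refutation (A ⊀ B) ψs unsat R f with finiteSubframe R ψs f
... | ws , ws⊆R , w∈ws , g with any? (λ w → ⟦ A ⟧ w Bool.≟ true ×-dec ⟦ B ⟧ w Bool.≟ false) ws
...   | yes some = let w , w∈ , ab = find some in w , All.lookup ws⊆R w∈ , ab
...   | no  none = ⊥-elim (unsat (_ , ⊩ˡ-∷ S imp g))
  where
  S : Frame
  S = (_∈ˡ ws) , w∈ws
  imp : S ⊩ A ≺ B
  imp w w∈ with ⟦ A ⟧ w in a | ⟦ B ⟧ w in b
  ... | false | _     = inj₁ refl
  ... | true  | true  = inj₂ refl
  ... | true  | false = ⊥-elim (none (lose w∈ (a , b)))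

-- Correctness of the arithmetized decision

code<⇒codedBelow : ∀ ψ {N} → codeSFormula ψ < N → CodedBelow N ψ
code<⇒codedBelow ψ {N} ψ<N = go ψ ψ<N
  where
  p≤2*p : ∀ p → p ≤ 2 * p
  p≤2*p p = m≤n*m p 2
  go : ∀ ψ → codeSFormula ψ < N → CodedBelow N ψ
  go (A ≺ B) ψ<N =
    ≤-<-trans (≤-trans (m≤⟨m,n⟩ _ (codeFormula B)) (p≤2*p _)) ψ<N ,
    ≤-<-trans (≤-trans (n≤⟨m,n⟩ (codeFormula A) _) (p≤2*p _)) ψ<N
  go (A ⊀ B) ψ<N = go (A ≺ B) (<-trans (n<1+n _) ψ<N)

codedBelow-negate : ∀ {N} φ → CodedBelow N φ → CodedBelow N (negate φ)
codedBelow-negate (A ≺ B) p = p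
codedBelow-negate (A ⊀ B) p = p

-- `insert` yields the canonical index of the theory with the negated conclusion added. A frame for
-- that theory would refute the consequence; if there is none, `refutation` applies.
consequence⇔ : ∀ Γ φ {n} → ⟨ codeFiniteSTheory Γ , codeSFormula φ ⟩ ≡ n →
  V (Γ , φ) ⇔ (¬ Satisfiableᶜ (suc n) (insert (flip (codeSFormula φ)) (codeFiniteSTheory Γ)))
consequence⇔ Γ@(T , ψs , finite) φ {n} refl = mk⇔ sound complete
  where
  N c : ℕ
  N = suc n
  c = insert (flip (codeSFormula φ)) (codeFiniteSTheory Γ)

  indexes : ∀ ψ → bit (codeSFormula ψ) c ≡ true ⇔ ψ ∈ˡ negate φ ∷ ψs
  indexes ψ = mk⇔ (λ p → uncode (to ix p)) (λ p → from ix (code p))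
    where
    ix = insert-indexes {flip (codeSFormula φ)} (canonicalIndex-indexes (map codeSFormula ψs)) (codeSFormula ψ)
    uncode : codeSFormula ψ ∈ˡ flip (codeSFormula φ) ∷ map codeSFormula ψs → ψ ∈ˡ negate φ ∷ ψs
    uncode (here eq) = here (codeSFormula-injective (trans eq (sym (code-negate φ))))
    uncode (there p) with χ , χ∈ , eq ← ∈-map⁻ codeSFormula p
      rewrite codeSFormula-injective {ψ} {χ} eq = there χ∈
    code : ψ ∈ˡ negate φ ∷ ψs → codeSFormula ψ ∈ˡ flip (codeSFormula φ) ∷ map codeSFormula ψs
    code (here refl) = here (code-negate φ)
    code (there p)   = there (∈-map⁺ codeSFormula p)

  below : ∀ {ψ} → ψ ∈ˡ negate φ ∷ ψs → CodedBelow N ψ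
  below (here refl) = codedBelow-negate φ (code<⇒codedBelow φ (s≤s (n≤⟨m,n⟩ (codeFiniteSTheory Γ) _)))
  -- Members of the theory have codes below its canonical index, which is at most `n`.
  below {ψ} (there p) = code<⇒codedBelow ψ
    (<-trans (bit⇒< _ _ (from (canonicalIndex-indexes (map codeSFormula ψs) _) (∈-map⁺ codeSFormula p)))
             (s≤s (m≤⟨m,n⟩ (codeFiniteSTheory Γ) _)))

  sound : T ⊨ φ → ¬ Satisfiableᶜ N c
  sound T⊨φ sat with R , f ← satisfiable-sound {N} {c} indexes below sat =
    ⊩-negate R φ (T⊨φ R λ ψ ψ∈T → f ψ (there (to (finite ψ) ψ∈T))) (f _ (here refl))

  complete : ¬ Satisfiableᶜ N c → T ⊨ φ
  complete unsat R f = refutation φ ψs (λ (S , g) → unsat (satisfiable-complete {N} {c} indexes below S g)) R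
    λ ψ ψ∈ → f ψ (from (finite ψ) ψ∈)

map-surjective : ∀ {A B : Set} {f : A → B} → (∀ y → ∃[ x ] f x ≡ y) → ∀ ys → ∃[ xs ] map f xs ≡ ys
map-surjective f-surjective [] = [] , refl
map-surjective f-surjective (y ∷ ys) with f-surjective y | map-surjective f-surjective ys
... | x , refl | xs , refl = x ∷ xs , refl

-- Recovers a theory and a conclusion from an arbitrary number that meets the numerical condition.
codePair-surjective : ∀ n → ∃[ x ] codePair x ≡ n
codePair-surjective n
  with ψs , eq₁ ← map-surjective codeSFormula-surjective (members (proj₁ (unpair n)))
     | φ , eq₂ ← codeSFormula-surjective (proj₂ (unpair n)) =
  ((_ , ψs , λ _ → ⇔-id _) , φ) ,
  trans (cong₂ ⟨_,_⟩ (trans (cong canonicalIndex eq₁) (canonicalIndex-members (proj₁ (unpair n)))) eq₂)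
        (pair-unpair n)

consequence-correct : ∀ n → Image codePair V n ⇔ holds consequence (n ∷ [])
consequence-correct n = mk⇔ fwd bwd
  where
  fwd : Image codePair V n → holds consequence (n ∷ [])
  fwd ((Γ , φ) , valid , refl) =
    codeFiniteSTheory Γ , s≤s (m≤⟨m,n⟩ (codeFiniteSTheory Γ) (codeSFormula φ)) ,
    codeSFormula φ , s≤s (n≤⟨m,n⟩ (codeFiniteSTheory Γ) (codeSFormula φ)) ,
    refl , to (consequence⇔ Γ φ refl) valid
  bwd : holds consequence (n ∷ []) → Image codePair V n
  bwd (a , _ , b , _ , ab≡n , unsat) with (Γ , φ) , eq ← codePair-surjective n
    -- Pairing is injective, so the components found by the search are the codes of `Γ` and `φ`.
    with refl ← pair-injective {a} {b} {codeFiniteSTheory Γ} (trans ab≡n (sym eq)) =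
    (Γ , φ) , from (consequence⇔ Γ φ eq) unsat , eq

-- `S` may live in a higher universe than `holds`, as the image of `V` does; hence the transfer
-- along an equivalence.
decision⇒computable : (φ : Decision 1) {S : Pred ℕ ℓ} →
                      (∀ n → n ∈ S ⇔ holds φ (n ∷ [])) → ComputableSet S
decision⇒computable φ {S} S⇔φ = program (χ φ) , decide
  where
  decide : ∀ n → (n ∈ S × program (χ φ) [ n ∷ [] ]⇓ 1) ⊎ (n ∉ S × program (χ φ) [ n ∷ [] ]⇓ 0)
  decide n with reflects φ (n ∷ []) | correct (χ φ) (n ∷ [])
  ... | inj₁ (p  , eq) | run = inj₁ (from (S⇔φ n) p , subst (program (χ φ) [ n ∷ [] ]⇓_) eq run)
  ... | inj₂ (¬p , eq) | run = inj₂ (¬p ∘ to (S⇔φ n) , subst (program (χ φ) [ n ∷ [] ]⇓_) eq run)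

theorem14 : ComputableUnder codePair V
theorem14 = decision⇒computable consequence consequence-correct
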